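{- Let $q$ be a prime power and $m,n$ positive integers. If $h_{q^m}(n)=k$, then $h_{\tau_3}(\mathbb{F}_q^{mn})\ge mk$. Consequently, if $h_{\tau_3}(\mathbb{F}_q^{mn})\le m-1$, then $h_{q^m}(n)=0$.
   Context: For a prime power $Q$ and $n\in\mathbb{N}$, with $\tau$ the cyclic shift $(u_1,\dots,u_n)\mapsto(u_n,u_1,\dots,u_{n-1})$ on $\mathbb{F}_Q^n$, a subspace $U$ is cyclically covering if $\bigcup_{i=0}^{n-1}\tau^i(U)=\mathbb{F}_Q^n$, and $h_Q(n)$ is the largest codimension of a cyclically covering subspace of $\mathbb{F}_Q^n$. Write vectors of $\mathbb{F}_q^{mn}$ as $(b_1,\dots,b_n)$ with blocks $b_i\in\mathbb{F}_q^m$ and let $\tau_3(b_1,\dots,b_n)=(b_n,b_1,\dots,b_{n-1})$ (the cyclic shift by $m$ coordinates; $\tau_3^n=\mathrm{id}$). A subspace $U\subseteq\mathbb{F}_q^{mn}$ is a $\tau_3$-covering if $\bigcup_{k=0}^{n-1}\tau_3^k(U)=\mathbb{F}_q^{mn}$, and $h_{\tau_3}(\mathbb{F}_q^{mn})$ is the largest codimension of a $\tau_3$-covering subspace. -}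

module Defs where

open import Level using (Level; _⊔_) renaming (suc to lsuc)
open import Algebra.Bundles using (CommutativeRing)
open import Data.Nat using (ℕ; zero; suc) renaming (_+_ to _+ℕ_; _*_ to _*ℕ_; _≤_ to _≤ℕ_)
open import Data.Fin using (Fin; zero; suc; fromℕ; inject₁; toℕ)
open import Data.Product using (Σ; ∃; _×_; _,_)
open import Relation.Nullary using (¬_)
open import Relation.Binary.PropositionalEquality using (_≡_)
open import Function using (_∘_)

record Field (c ℓ : Level) : Set (lsuc (c ⊔ ℓ)) where
  field
    commutativeRing : CommutativeRing c ℓ
  open CommutativeRing commutativeRing public
  field
    1≉0     : ¬ (1# ≈ 0#)
    inverse : ∀ x → ¬ (x ≈ 0#) → ∃ λ y → (x * y) ≈ 1#

HasCard : ∀ {c ℓ} → Field c ℓ → ℕ → Set (c ⊔ ℓ)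
HasCard F q = Σ (Fin q → Carrier) λ e →
    (∀ x → ∃ λ i → e i ≈ x) × (∀ i j → e i ≈ e j → i ≡ j)
  where open Field F

module LinAlg {c ℓ} (F : Field c ℓ) where
  open Field F using (Carrier; _≈_; _+_; _*_; 0#)

  Vec : Set → Set c
  Vec I = I → Carrier

  _≈v_ : ∀ {I} → Vec I → Vec I → Set ℓ
  u ≈v v = ∀ i → u i ≈ v i

  0v : ∀ {I} → Vec I
  0v _ = 0#

  _+v_ : ∀ {I} → Vec I → Vec I → Vec I
  (u +v v) i = u i + v i

  _·v_ : ∀ {I} → Carrier → Vec I → Vec I
  (a ·v v) i = a * v i

  lincomb : ∀ {I} d → (Fin d → Carrier) → (Fin d → Vec I) → Vec I
  lincomb zero    cs bs = 0v
  lincomb (suc d) cs bs = (cs zero ·v bs zero) +v lincomb d (cs ∘ suc) (bs ∘ suc)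

  Subset : Set → Set (lsuc (c ⊔ ℓ))
  Subset I = Vec I → Set (c ⊔ ℓ)

  record IsSubspace {I : Set} (U : Subset I) : Set (c ⊔ ℓ) where
    field
      respects : ∀ {u v} → u ≈v v → U u → U v
      has-0    : U 0v
      closed-+ : ∀ {u v} → U u → U v → U (u +v v)
      closed-· : ∀ a {u} → U u → U (a ·v u)

  LinIndep : ∀ {I} d → (Fin d → Vec I) → Set (c ⊔ ℓ)
  LinIndep d bs = ∀ cs → lincomb d cs bs ≈v 0v → ∀ i → cs i ≈ 0#

  HasDim : ∀ {I} → Subset I → ℕ → Set (c ⊔ ℓ)
  HasDim U d = Σ (Fin d → Vec _) λ bs →
      (∀ i → U (bs i)) × LinIndep d bs
      × (∀ u → U u → ∃ λ cs → u ≈v lincomb d cs bs)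

  -- U ⊆ F^I, where the ambient space has dimension N (|I| = N), has codimension k
  HasCodim : ∀ {I} → ℕ → Subset I → ℕ → Set (c ⊔ ℓ)
  HasCodim N U k = ∃ λ d → HasDim U d × (d +ℕ k ≡ N)

  image : ∀ {I} → (Vec I → Vec I) → Subset I → Subset I
  image f U x = ∃ λ u → U u × (x ≈v f u)

  iter : ∀ {A : Set c} → (A → A) → ℕ → A → A
  iter f zero    = λ a → a
  iter f (suc k) = f ∘ iter f k

  Covering : ∀ {I} → (Vec I → Vec I) → ℕ → Subset I → Set (c ⊔ ℓ)
  Covering σ n U = ∀ x → ∃ λ (i : Fin n) → image (iter σ (toℕ i)) U x

  IsMaxCoveringCodim : ∀ {I} → ℕ → (Vec I → Vec I) → ℕ → ℕ → Set (lsuc (c ⊔ ℓ))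
  IsMaxCoveringCodim {I} N σ n k =
      (∃ λ (U : Subset I) → IsSubspace U × Covering σ n U × HasCodim N U k)
    × (∀ (U : Subset I) k' → IsSubspace U → Covering σ n U → HasCodim N U k' → k' ≤ℕ k)

-- index shift on Fin n : j ↦ j - 1 (mod n), so that (u ∘ rot) is the cyclic shift
-- (u_1,…,u_n) ↦ (u_n,u_1,…,u_{n-1})
rot : ∀ {n} → Fin n → Fin n
rot {suc n} zero    = fromℕ n
rot {suc n} (suc j) = inject₁ j

module _ {c ℓ} (F : Field c ℓ) where
  open LinAlg F

  τ : ∀ {n} → Vec (Fin n) → Vec (Fin n)
  τ u = u ∘ rot

  -- τ₃ on F^{mn}, vectors written as n blocks b_1..b_n in F^m (index (block, position))
  τ₃ : ∀ {n m} → Vec (Fin n × Fin m) → Vec (Fin n × Fin m)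
  τ₃ u (j , p) = u (rot j , p)

  hIs : ℕ → ℕ → Set (lsuc (c ⊔ ℓ))
  hIs n k = IsMaxCoveringCodim n (τ {n}) n k

  hτ₃Is : ℕ → ℕ → ℕ → Set (lsuc (c ⊔ ℓ))
  hτ₃Is m n k = IsMaxCoveringCodim (m *ℕ n) (τ₃ {n} {m}) n k

{-# OPTIONS --safe #-}
module Submission where

-- An embedding of K = F_q into L = F_{q^m} makes L a K-vector space, of dimension m by counting, and
-- choosing a K-basis of L identifies L^n with K^{mn} blockwise, so that τ becomes τ₃ and an L-subspace of
-- codimension k becomes a K-subspace of codimension mk.
--
-- The embedding is found without constructing finite fields.  Both fields satisfy x^N = x and have the same
-- characteristic, where N = |L|.  A polynomial over ℕ in several variables reduces, modulo X^N - X in each of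
-- them, to one of degree < N in each variable; if the reduced polynomial vanishes on all of L, then its
-- coefficients vanish in L, hence in K.  Apply this to the polynomial in the variables X_a (a ∈ K)
-- Π (1 - r^(N-1)), r running over X_1 - 1, X_{a+b} - X_a - X_b and X_{ab} - X_a X_b: it is 1 at X_a = a in K,
-- so it is nonzero at some X_a = φ(a) in L, and φ satisfies all the relations r.

open import Defs
open import Level using (Level; _⊔_; 0ℓ)
open import Algebra.Bundles using (Semiring)
open import Algebra.Bundles.Raw using (RawRing)
open import Algebra.Morphism.Structures using (IsRingMonomorphism)
import Algebra.Morphism.RingMonomorphism as RingMonomorphism
import Algebra.Properties.Semiring.Exp
import Algebra.Properties.Semiring.Sum
import Algebra.Solver.Ring.NaturalCoefficients.Default
open import Data.Empty using (⊥-elim)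
open import Data.Fin as Fin using (Fin; zero; suc; toℕ; punchIn; funToFin; finToFun; _↑ˡ_; _↑ʳ_; combine; remQuot)
import Data.Fin.Properties as Finₚ
open import Data.Fin.Permutation using (Permutation′; permutation; _⟨$⟩ʳ_)
open import Data.Nat as ℕ using (ℕ; zero; suc; NonZero)
import Data.Nat.Properties as ℕₚ
open import Data.Nat.DivMod using (_mod_; _%_; _/_; m≡m%n+[m/n]*n; m%n<n)
open import Data.Nat.Divisibility using (_∣_; divides; m%n≡0⇒n∣m; m∣m*n)
open import Data.Nat.Solver using (module +-*-Solver)
open import Data.Product using (∃; _×_; _,_; proj₁; proj₂; uncurry)
open import Data.Sum using (inj₁; inj₂)
open import Data.Vec as Vec using (Vec; []; _∷_)
open import Data.Vec.Functional as Vector using (removeAt)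
open import Data.Vec.Relation.Unary.All as All using (All; []; _∷_)
open import Data.Vec.Relation.Unary.Any using (Any; here; there)
open import Data.Vec.Relation.Unary.Any.Properties using (map⁺; map⁻)
open import Function using (_∘_)
open import Relation.Nullary using (¬_; Dec; yes; no; contradiction)
open import Relation.Nullary.Decidable as Dec using ()
open import Relation.Binary.Definitions using (tri<; tri≈; tri>)
open import Relation.Binary.PropositionalEquality as ≡ using (_≡_)

-- Finite fields: x^|F| = x, and polynomials with many roots

module FiniteField {c ℓ} (F : Field c ℓ) {N : ℕ} (card : HasCard F N) where
  open Field F hiding (zero; _-_)
  open import Algebra.Properties.Semiring.Exp semiring using (_^_; ^-congˡ)
  open import Algebra.Properties.Semiring.Mult semiring using () renaming (_×_ to _×′_)
  open import Algebra.Properties.Ring ring using (+-cancelʳ)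
  import Algebra.Properties.CommutativeMonoid.Sum as CMSum
  module Σ+ = CMSum +-commutativeMonoid
  module Π* = CMSum *-commutativeMonoid
  open import Relation.Binary.Reasoning.Setoid setoid

  elem : Fin N → Carrier
  elem = proj₁ card

  index : Carrier → Fin N
  index x = proj₁ (proj₁ (proj₂ card) x)

  elem-index : ∀ x → elem (index x) ≈ x
  elem-index x = proj₂ (proj₁ (proj₂ card) x)

  elem-injective : ∀ {i j} → elem i ≈ elem j → i ≡ j
  elem-injective = proj₂ (proj₂ card) _ _

  index-cong : ∀ {x y} → x ≈ y → index x ≡ index y
  index-cong x≈y = elem-injective (trans (elem-index _) (trans x≈y (sym (elem-index _))))

  index-injective : ∀ {x y} → index x ≡ index y → x ≈ y
  index-injective eq = trans (sym (elem-index _)) (trans (reflexive (≡.cong elem eq)) (elem-index _))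

  index-elem : ∀ i → index (elem i) ≡ i
  index-elem i = elem-injective (elem-index _)

  infix 4 _≈?_
  _≈?_ : ∀ x y → Dec (x ≈ y)
  x ≈? y = Dec.map′ index-injective index-cong (index x Finₚ.≟ index y)

  *-cancelˡ-nonZero : ∀ {x y z} → ¬ x ≈ 0# → x * y ≈ x * z → y ≈ z
  *-cancelˡ-nonZero {x} {y} {z} x≉0 eq with w , xw≈1 ← inverse x x≉0 =
      trans (sym (unit y)) (trans (*-congˡ eq) (unit z))
    where
    unit : ∀ u → w * (x * u) ≈ u
    unit u = trans (sym (*-assoc _ _ _)) (trans (*-congʳ (trans (*-comm w x) xw≈1)) (*-identityˡ u))

  *≉0 : ∀ {x y} → ¬ x ≈ 0# → ¬ y ≈ 0# → ¬ x * y ≈ 0#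
  *≉0 x≉0 y≉0 eq = y≉0 (*-cancelˡ-nonZero x≉0 (trans eq (sym (zeroʳ _))))

  ^≉0 : ∀ {x} n → ¬ x ≈ 0# → ¬ x ^ n ≈ 0#
  ^≉0 zero    x≉0 = 1≉0
  ^≉0 (suc n) x≉0 = *≉0 x≉0 (^≉0 n x≉0)

  -- Lets sums and products over all elements be rearranged along translations and scalings, which
  -- are bijections of the field rather than of the index set.
  reindexing : (f g : Carrier → Carrier) → (∀ {x y} → x ≈ y → f x ≈ f y) → (∀ {x y} → x ≈ y → g x ≈ g y) →
               (∀ x → f (g x) ≈ x) → (∀ x → g (f x) ≈ x) → Permutation′ N
  reindexing f g f-cong g-cong fg gf =
      permutation (index ∘ f ∘ elem) (index ∘ g ∘ elem) (inv f-cong fg) (inv g-cong gf)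
    where
    inv : ∀ {h k : Carrier → Carrier} → (∀ {x y} → x ≈ y → h x ≈ h y) → (∀ x → h (k x) ≈ x) →
          ∀ i → index (h (elem (index (k (elem i))))) ≡ i
    inv h-cong hk i = ≡.trans (index-cong (trans (h-cong (elem-index _)) (hk _))) (index-elem i)

  -- Translation by 1 permutes the field, so the sum of all elements equals itself plus `N` times 1;
  -- cancel the sum.
  card×1≈0 : N ×′ 1# ≈ 0#
  card×1≈0 = sym (+-cancelʳ (Σ+.sum elem) _ _ (begin
    0# + Σ+.sum elem               ≈⟨ +-identityˡ _ ⟩
    Σ+.sum elem                    ≈⟨ Σ+.sum-permute elem shift ⟩
    Σ+.sum (elem ∘ (shift ⟨$⟩ʳ_))   ≈⟨ Σ+.sum-cong-≋ (λ i → elem-index (1# + elem i)) ⟩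
    Σ+.sum (λ i → 1# + elem i)     ≈⟨ Σ+.∑-distrib-+ (λ _ → 1#) elem ⟩
    Σ+.sum {N} (λ _ → 1#) + Σ+.sum elem  ≈⟨ +-congʳ (Σ+.sum-replicate N) ⟩
    N ×′ 1# + Σ+.sum elem          ∎))
    where
    shift = reindexing (1# +_) (- 1# +_) +-congˡ +-congˡ
      (λ x → trans (sym (+-assoc _ _ _)) (trans (+-congʳ (-‿inverseʳ 1#)) (+-identityˡ x)))
      (λ x → trans (sym (+-assoc _ _ _)) (trans (+-congʳ (-‿inverseˡ 1#)) (+-identityˡ x)))

  Π*≉0 : ∀ {n} {t : Fin n → Carrier} → (∀ i → ¬ t i ≈ 0#) → ¬ Π*.sum t ≈ 0#
  Π*≉0 {zero}  t≉0 = 1≉0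
  Π*≉0 {suc n} t≉0 = *≉0 (t≉0 zero) (Π*≉0 (t≉0 ∘ suc))

  Π*-const-except : ∀ {n x} {t : Fin n → Carrier} i → t i ≈ 1# → (∀ j → ¬ j ≡ i → t j ≈ x) → Π*.sum t * x ≈ x ^ n
  Π*-const-except {suc n} {x} {t} i tᵢ≈1 tⱼ≈x = begin
    Π*.sum t * x                      ≈⟨ *-congʳ (Π*.sum-remove {i = i} t) ⟩
    t i * Π*.sum (removeAt t i) * x
        ≈⟨ *-congʳ (*-cong tᵢ≈1 (Π*.sum-cong-≋ λ j → tⱼ≈x (punchIn i j) (Finₚ.punchInᵢ≢i i j))) ⟩
    1# * Π*.sum {n} (λ _ → x) * x     ≈⟨ *-congʳ (trans (*-identityˡ _) (Π*.sum-replicate n)) ⟩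
    x ^ n * x                         ≈⟨ *-comm _ _ ⟩
    x ^ suc n                         ∎

  0^card≈0 : 0# ^ N ≈ 0#
  -- The index of 0 is an element of `Fin N`, hence `N` is positive.
  0^card≈0 = 0^n≈0 (index 0#)
    where
    0^n≈0 : ∀ {n} → Fin n → 0# ^ n ≈ 0#
    0^n≈0 {suc n} _ = zeroˡ _

  -- Comparing the product of all nonzero elements with its image under multiplication by x.
  x^card≈x : ∀ x → x ^ N ≈ x
  x^card≈x x with x ≈? 0#
  ... | yes x≈0 = trans (^-congˡ N x≈0) (trans 0^card≈0 (sym x≈0))
  ... | no  x≉0 with x⁻¹ , xx⁻¹≈1 ← inverse x x≉0 = begin
    x ^ N
        ≈⟨ Π*-const-except (index 0#) (u-zero (elem-index 0#))
            (λ j j≢0 → u-nonzero (λ eⱼ≈0 → j≢0 (elem-injective (trans eⱼ≈0 (sym (elem-index 0#)))))) ⟨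
    Π*.sum (u ∘ elem) * x  ≈⟨ *-congʳ Πu≈1 ⟩
    1# * x           ≈⟨ *-identityˡ x ⟩
    x                ∎
    where
    -- `nz` replaces 0 by 1, so its product over the whole field is the product of the nonzero
    -- elements; `u` is the factor by which `nz` changes when its argument is multiplied by `x`.
    nz u : Carrier → Carrier
    nz y with y ≈? 0#
    ... | yes _ = 1#
    ... | no  _ = y
    u y with y ≈? 0#
    ... | yes _ = 1#
    ... | no  _ = x

    u-zero : ∀ {y} → y ≈ 0# → u y ≈ 1#
    u-zero {y} y≈0 with y ≈? 0#
    ... | yes _   = refl
    ... | no  y≉0 = contradiction y≈0 y≉0

    u-nonzero : ∀ {y} → ¬ y ≈ 0# → u y ≈ x
    u-nonzero {y} y≉0 with y ≈? 0#
    ... | yes y≈0 = contradiction y≈0 y≉0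
    ... | no  _   = refl

    nz≉0 : ∀ y → ¬ nz y ≈ 0#
    nz≉0 y with y ≈? 0#
    ... | yes _   = 1≉0
    ... | no  y≉0 = y≉0

    nz-cong : ∀ {y z} → y ≈ z → nz y ≈ nz z
    nz-cong {y} {z} y≈z with y ≈? 0# | z ≈? 0#
    ... | yes _   | yes _   = refl
    ... | yes y≈0 | no  z≉0 = contradiction (trans (sym y≈z) y≈0) z≉0
    ... | no  y≉0 | yes z≈0 = contradiction (trans y≈z z≈0) y≉0
    ... | no  _   | no  _   = y≈z

    nz-* : ∀ y → nz (x * y) ≈ u y * nz y
    nz-* y with x * y ≈? 0# | y ≈? 0#
    ... | yes _    | yes _   = sym (*-identityˡ 1#)
    ... | yes xy≈0 | no  y≉0 = contradiction xy≈0 (*≉0 x≉0 y≉0)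
    ... | no  xy≉0 | yes y≈0 = contradiction (trans (*-congˡ y≈0) (zeroʳ x)) xy≉0
    ... | no  _    | no  _   = refl

    scaling : Permutation′ N
    scaling = reindexing (x *_) (x⁻¹ *_) *-congˡ *-congˡ
      (λ y → trans (sym (*-assoc _ _ _)) (trans (*-congʳ xx⁻¹≈1) (*-identityˡ y)))
      (λ y → trans (sym (*-assoc _ _ _)) (trans (*-congʳ (trans (*-comm _ _) xx⁻¹≈1)) (*-identityˡ y)))

    Πu≈1 : Π*.sum (u ∘ elem) ≈ 1#
    Πu≈1 = *-cancelˡ-nonZero (Π*≉0 (nz≉0 ∘ elem)) (begin
      Π*.sum (nz ∘ elem) * Π*.sum (u ∘ elem)        ≈⟨ *-comm _ _ ⟩
      Π*.sum (u ∘ elem) * Π*.sum (nz ∘ elem)        ≈⟨ Π*.∑-distrib-+ (u ∘ elem) (nz ∘ elem) ⟨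
      Π*.sum (λ i → u (elem i) * nz (elem i))
          ≈⟨ Π*.sum-cong-≋ (λ i → trans (nz-cong (elem-index _)) (nz-* (elem i))) ⟨
      Π*.sum (nz ∘ elem ∘ (scaling ⟨$⟩ʳ_))           ≈⟨ Π*.sum-permute (nz ∘ elem) scaling ⟨
      Π*.sum (nz ∘ elem)                            ≈⟨ *-identityʳ _ ⟨
      Π*.sum (nz ∘ elem) * 1#                       ∎)

  -- Polynomials in one variable, as coefficient vectors with the constant term first

  private
    module ℕSolver = Algebra.Solver.Ring.NaturalCoefficients.Default commutativeSemiring

  eval : ∀ {n} → Vec Carrier n → Carrier → Carrier
  eval []      x = 0#
  eval (a ∷ v) x = a + x * eval v x

  -- Synthetic division by X - r: the coefficients of the quotient are the Horner values at `r` of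
  -- the proper tails, and the remainder `eval v r` is dropped.
  quotient : ∀ {n} → Vec Carrier (suc n) → Carrier → Vec Carrier n
  quotient (_ ∷ [])      r = []
  quotient (_ ∷ b ∷ v) r = eval (b ∷ v) r ∷ quotient (b ∷ v) r

  -- v(x) - v(r) = (x - r) quotient(x), with the terms moved so that no subtraction occurs.
  eval-quotient : ∀ {n} (v : Vec Carrier (suc n)) r x →
                  eval v x + r * eval (quotient v r) x ≈ eval v r + x * eval (quotient v r) x
  eval-quotient (a ∷ []) r x = +-cong (+-congˡ (trans (zeroʳ x) (sym (zeroʳ r)))) (trans (zeroʳ r) (sym (zeroʳ x)))
  eval-quotient (a ∷ b ∷ v) r x = begin
    (a + x * wx) + r * (wr + x * Q)
        ≈⟨ solve 6 (λ a x r wx wr Q → (a :+ x :* wx) :+ r :* (wr :+ x :* Q) :=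
            (a :+ r :* wr) :+ x :* (wx :+ r :* Q)) refl a x r wx wr Q ⟩
    (a + r * wr) + x * (wx + r * Q)   ≈⟨ +-congˡ (*-congˡ (eval-quotient (b ∷ v) r x)) ⟩
    (a + r * wr) + x * (wr + x * Q)   ∎
    where
    open ℕSolver
    wx = eval (b ∷ v) x
    wr = eval (b ∷ v) r
    Q  = eval (quotient (b ∷ v) r) x

  -- Each coefficient is the Horner value of its tail minus `r` times the value of the next tail,
  -- and all these values vanish.
  quotient≈0⇒≈0 : ∀ {n} (v : Vec Carrier (suc n)) r → eval v r ≈ 0# → All (_≈ 0#) (quotient v r) → All (_≈ 0#) v
  quotient≈0⇒≈0 (a ∷ [])    r vr≈0 []             =
      trans (trans (sym (+-identityʳ a)) (+-congˡ (sym (zeroʳ r)))) vr≈0 ∷ []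
  quotient≈0⇒≈0 (a ∷ b ∷ v) r vr≈0 (wr≈0 ∷ Q≈0) =
    trans (trans (sym (+-identityʳ a)) (+-congˡ (sym (trans (*-congˡ wr≈0) (zeroʳ r))))) vr≈0
      ∷ quotient≈0⇒≈0 (b ∷ v) r wr≈0 Q≈0

  -- Induction on the length: dividing by X - r₀ leaves a quotient that has all the other roots.
  roots⇒≈0 : ∀ {n} (v : Vec Carrier n) (r : Fin n → Carrier) → (∀ {i j} → r i ≈ r j → i ≡ j) →
             (∀ i → eval v (r i) ≈ 0#) → All (_≈ 0#) v
  roots⇒≈0 {zero}  []  r r-inj v[r]≈0 = []
  roots⇒≈0 {suc n} v r r-inj v[r]≈0 =
    quotient≈0⇒≈0 v r₀ (v[r]≈0 zero) (roots⇒≈0 (quotient v r₀) (r ∘ suc) (Finₚ.suc-injective ∘ r-inj) Q[r]≈0)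
    where
    r₀ = r zero
    Q[r]≈0 : ∀ i → eval (quotient v r₀) (r (suc i)) ≈ 0#
    Q[r]≈0 i with eval (quotient v r₀) (r (suc i)) ≈? 0#
    ... | yes Q≈0 = Q≈0
    -- If the quotient had a nonzero value Q at rᵢ, then `eval-quotient` would give r₀ Q = rᵢ Q,
    -- hence r₀ = rᵢ.
    ... | no  Q≉0 = contradiction (r-inj (*-cancelˡ-nonZero Q≉0 (begin
      Q * r₀         ≈⟨ *-comm _ _ ⟩
      r₀ * Q         ≈⟨ +-identityˡ _ ⟨
      0# + r₀ * Q    ≈⟨ +-congʳ (v[r]≈0 (suc i)) ⟨
      eval v rᵢ + r₀ * Q   ≈⟨ eval-quotient v r₀ rᵢ ⟩
      eval v r₀ + rᵢ * Q   ≈⟨ +-congʳ (v[r]≈0 zero) ⟩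
      0# + rᵢ * Q    ≈⟨ +-identityˡ _ ⟩
      rᵢ * Q         ≈⟨ *-comm _ _ ⟩
      Q * rᵢ         ∎))) λ ()
      where
      rᵢ = r (suc i)
      Q  = eval (quotient v r₀) rᵢ

  -- Length `N` means degree below `N`, so vanishing at all `N` elements would force every
  -- coefficient to be zero.
  ≉0⇒nonRoot : (v : Vec Carrier N) → Any (λ a → ¬ a ≈ 0#) v → ∃ λ x → ¬ eval v x ≈ 0#
  ≉0⇒nonRoot v v≉0 with Finₚ.any? (λ i → Dec.¬? (eval v (elem i) ≈? 0#))
  ... | yes (i , vᵢ≉0) = elem i , vᵢ≉0
  ... | no  ∄          = ⊥-elim (All.lookupWith (λ a≈0 a≉0 → a≉0 a≈0) v≈0 v≉0)
    where
    v≈0 = roots⇒≈0 v elem elem-injective λ i → Dec.decidable-stable (eval v (elem i) ≈? 0#) λ vᵢ≉0 → ∄ (i , vᵢ≉0)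

  eval≉0⇒≉0 : ∀ {n} (v : Vec Carrier n) x → ¬ eval v x ≈ 0# → Any (λ a → ¬ a ≈ 0#) v
  eval≉0⇒≉0 []      x vx≉0 = contradiction refl vx≉0
  eval≉0⇒≉0 (a ∷ v) x vx≉0 with a ≈? 0#
  ... | no  a≉0 = here a≉0
  ... | yes a≈0 =
      there (eval≉0⇒≉0 v x λ v[x]≈0 → vx≉0 (trans (+-cong a≈0 (trans (*-congˡ v[x]≈0) (zeroʳ x))) (+-identityʳ 0#)))

  card>1 : 1 ℕ.< N
  card>1 = two-elements (index 0#) (index 1#) (λ eq → 1≉0 (sym (index-injective eq)))
    where
    two-elements : ∀ {n} (i j : Fin n) → ¬ i ≡ j → 1 ℕ.< n
    two-elements {1}           zero zero i≢j = contradiction ≡.refl i≢j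
    two-elements {suc (suc n)} i    j    i≢j = ℕ.s≤s (ℕ.s≤s ℕ.z≤n)

  power≈1 : ∀ {x M} → N ≡ suc M → ¬ x ≈ 0# → x ^ M ≈ 1#
  power≈1 {x} ≡.refl x≉0 = *-cancelˡ-nonZero x≉0 (trans (x^card≈x x) (sym (*-identityʳ x)))

-- Bases of finite extensions

record Homomorphism {c ℓ c′ ℓ′} (K : Field c ℓ) (L : Field c′ ℓ′) : Set (c ⊔ ℓ ⊔ c′ ⊔ ℓ′) where
  private
    module K = Field K
    module L = Field L
  open L using (_≈_)
  field
    map    : K.Carrier → L.Carrier
    cong   : ∀ {x y} → x K.≈ y → map x ≈ map y
    +-homo : ∀ x y → map (x K.+ y) ≈ map x L.+ map y
    *-homo : ∀ x y → map (x K.* y) ≈ map x L.* map y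
    1-homo : map K.1# ≈ L.1#

  open import Algebra.Properties.Ring L.ring using (+-cancelʳ)

  0-homo : map K.0# ≈ L.0#
  0-homo = +-cancelʳ (map K.0#) _ _
      (L.trans (L.sym (+-homo K.0# K.0#)) (L.trans (cong (K.+-identityˡ K.0#)) (L.sym (L.+-identityˡ _))))

module FiniteExtension {c ℓ c′ ℓ′} {K : Field c ℓ} {L : Field c′ ℓ′} (φ : Homomorphism K L)
                       {q N : ℕ} (cardK : HasCard K q) (cardL : HasCard L N) where
  private
    module K = Field K
    module L = Field L
    module φ = Homomorphism φ
    module FK = FiniteField K cardK
    module FL = FiniteField L cardL
  open L hiding (zero; _-_)
  open import Algebra.Properties.Semiring.Sum semiring
  open import Algebra.Properties.Ring L.ring using (+-cancelʳ)
  open import Algebra.Properties.Ring K.ring using (x∙y⁻¹≈ε⇒x≈y)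
  open import Relation.Binary.Reasoning.Setoid setoid

  comb : ∀ {d} → (Fin d → K.Carrier) → (Fin d → Carrier) → Carrier
  comb {d} cs b = ∑[ i < d ] (φ.map (cs i) * b i)

  comb-cong : ∀ {d} {cs cs′ : Fin d → K.Carrier} b → (∀ i → cs i K.≈ cs′ i) → comb cs b ≈ comb cs′ b
  comb-cong b cs≈cs′ = sum-cong-≋ λ i → *-congʳ (φ.cong (cs≈cs′ i))

  comb-+ : ∀ {d} cs cs′ (b : Fin d → Carrier) → comb (λ i → cs i K.+ cs′ i) b ≈ comb cs b + comb cs′ b
  comb-+ cs cs′ b = trans (sum-cong-≋ λ i → trans (*-congʳ (φ.+-homo (cs i) (cs′ i))) (distribʳ (b i) _ _))
                          (∑-distrib-+ (λ i → φ.map (cs i) * b i) (λ i → φ.map (cs′ i) * b i))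

  comb-* : ∀ {d} a cs (b : Fin d → Carrier) → comb (λ i → a K.* cs i) b ≈ φ.map a * comb cs b
  comb-* a cs b = trans (sum-cong-≋ λ i → trans (*-congʳ (φ.*-homo a (cs i))) (*-assoc _ _ _))
                        (sym (*-distribˡ-sum (φ.map a) (λ i → φ.map (cs i) * b i)))

  comb-0 : ∀ {d} (b : Fin d → Carrier) → comb (λ _ → K.0#) b ≈ 0#
  comb-0 {d} b = trans (sum-cong-≋ {d} λ i → trans (*-congʳ φ.0-homo) (zeroˡ (b i))) (sum-replicate-zero d)

  Independent : ∀ {d} → (Fin d → Carrier) → Set _
  Independent {d} b = ∀ cs → comb cs b ≈ 0# → ∀ (i : Fin d) → cs i K.≈ K.0#

  Spanned : ∀ {d} → (Fin d → Carrier) → Carrier → Set _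
  Spanned b x = ∃ λ cs → x ≈ comb cs b

  -- Decided by search: the coefficient tuples are coded by the finite set `Fin (q ^ d)`.
  spanned? : ∀ {d} (b : Fin d → Carrier) x → Dec (Spanned b x)
  spanned? {d} b x = Dec.map′
    (λ (k , x≈) → FK.elem ∘ finToFun k , x≈)
    (λ (cs , x≈) → funToFin (FK.index ∘ cs) , trans x≈ (comb-cong b λ i →
        K.trans (K.sym (FK.elem-index (cs i)))
            (K.reflexive (≡.cong FK.elem (≡.sym (Finₚ.finToFun-funToFin (FK.index ∘ cs) i))))))
    (Finₚ.any? λ (k : Fin (q ℕ.^ d)) → x FL.≈? comb (FK.elem ∘ finToFun k) b)

  -- A relation in which `x` has a nonzero coefficient can be solved for `x`, which would put `x` in
  -- the span; so that coefficient is zero and a relation among `b` remains.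
  extend-independent : ∀ {d} {b : Fin d → Carrier} {x} → Independent b → ¬ Spanned b x → Independent (x Vector.∷ b)
  extend-independent {d} {b} {x} b-indep x∉⟨b⟩ cs cs·xb≈0 = λ where
      zero    → c₀≈0
      (suc i) → b-indep (cs ∘ suc) (begin
        comb (cs ∘ suc) b                 ≈⟨ +-identityˡ _ ⟨
        0# + comb (cs ∘ suc) b            ≈⟨ +-congʳ (trans (*-congʳ (trans (φ.cong c₀≈0) φ.0-homo)) (zeroˡ x)) ⟨
        φ.map c₀ * x + comb (cs ∘ suc) b  ≈⟨ cs·xb≈0 ⟩
        0#                                ∎) i
    where
    c₀ = cs zero
    c₀≈0 : c₀ K.≈ K.0#
    c₀≈0 with c₀ FK.≈? K.0#
    ... | yes eq = eq
    ... | no  c₀≉0 with y , c₀y≈1 ← K.inverse c₀ c₀≉0 =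
        contradiction ((λ i → K.- y K.* cs (suc i)) , +-cancelʳ (comb (λ i → y K.* cs (suc i)) b) _ _ (begin
      x + comb (λ i → y K.* cs (suc i)) b
          ≈⟨ +-cong (trans (*-congʳ (trans (φ.cong (K.trans (K.*-comm y c₀) c₀y≈1)) φ.1-homo)) (*-identityˡ x)) refl ⟨
      comb (λ i → y K.* cs i) (x Vector.∷ b)             ≈⟨ comb-* y cs (x Vector.∷ b) ⟩
      φ.map y * comb cs (x Vector.∷ b)                   ≈⟨ trans (*-congˡ cs·xb≈0) (zeroʳ _) ⟩
      0#                                                 ≈⟨ comb-0 b ⟨
      comb (λ _ → K.0#) b
          ≈⟨ comb-cong b (λ i → K.trans (K.sym (K.distribʳ (cs (suc i)) (K.- y) y))
              (K.trans (K.*-congʳ (K.-‿inverseˡ y)) (K.zeroˡ _))) ⟨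
      comb (λ i → K.- y K.* cs (suc i) K.+ y K.* cs (suc i)) b  ≈⟨ comb-+ _ _ b ⟩
      comb (λ i → K.- y K.* cs (suc i)) b + comb (λ i → y K.* cs (suc i)) b  ∎)) x∉⟨b⟩

  -- Greedy choice: an element of the list is kept exactly when the elements kept so far do not span
  -- it.
  independent-spanning : ∀ {k} (e : Fin k → Carrier) →
                         ∃ λ d → ∃ λ (b : Fin d → Carrier) → Independent b × (∀ i → Spanned b (e i))
  independent-spanning {zero}  e = 0 , (λ ()) , (λ _ _ ()) , λ ()
  independent-spanning {suc k} e with d , b , b-indep , b-span ← independent-spanning (e ∘ suc) | spanned? b (e zero)
  ... | yes e₀∈⟨b⟩ = d , b , b-indep , λ { zero → e₀∈⟨b⟩ ; (suc i) → b-span i }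
  ... | no  e₀∉⟨b⟩ = suc d , e zero Vector.∷ b , extend-independent b-indep e₀∉⟨b⟩ , λ where
    zero    → K.1# Vector.∷ (λ _ → K.0#) ,
        sym (trans (+-cong (trans (*-congʳ φ.1-homo) (*-identityˡ _)) (comb-0 b)) (+-identityʳ _))
    (suc i) → let cs , eᵢ≈ = b-span i in
      K.0# Vector.∷ cs , trans eᵢ≈ (sym (trans (+-congʳ (trans (*-congʳ φ.0-homo) (zeroˡ _))) (+-identityˡ _)))

  abstract
    spanning : ∃ λ d → ∃ λ (b : Fin d → Carrier) → Independent b × (∀ i → Spanned b (FL.elem i))
    spanning = independent-spanning FL.elem

  degree : ℕ
  degree = proj₁ spanning

  basis : Fin degree → Carrier
  basis = proj₁ (proj₂ spanning)

  basis-independent : Independent basis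
  basis-independent = proj₁ (proj₂ (proj₂ spanning))

  coord : Carrier → Fin degree → K.Carrier
  coord x = proj₁ (proj₂ (proj₂ (proj₂ spanning)) (FL.index x))

  comb-coord : ∀ x → comb (coord x) basis ≈ x
  comb-coord x = sym (trans (sym (FL.elem-index x)) (proj₂ (proj₂ (proj₂ (proj₂ spanning)) (FL.index x))))

  comb-injective : ∀ cs cs′ → comb cs basis ≈ comb cs′ basis → ∀ i → cs i K.≈ cs′ i
  comb-injective cs cs′ eq i =
      x∙y⁻¹≈ε⇒x≈y _ _ (basis-independent (λ i → cs i K.+ K.- cs′ i) (+-cancelʳ (comb cs′ basis) _ _ (begin
    comb (λ i → cs i K.+ K.- cs′ i) basis + comb cs′ basis    ≈⟨ comb-+ _ cs′ basis ⟨
    comb (λ i → cs i K.+ K.- cs′ i K.+ cs′ i) basis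
        ≈⟨ comb-cong basis (λ i → K.trans (K.+-assoc _ _ _)
            (K.trans (K.+-congˡ (K.-‿inverseˡ _)) (K.+-identityʳ _))) ⟩
    comb cs basis                                             ≈⟨ eq ⟩
    comb cs′ basis                                            ≈⟨ +-identityˡ _ ⟨
    0# + comb cs′ basis                                       ∎)) i)

  coord-comb : ∀ cs i → coord (comb cs basis) i K.≈ cs i
  coord-comb cs = comb-injective _ cs (comb-coord _)

  coord-cong : ∀ {x y} → x ≈ y → ∀ i → coord x i K.≈ coord y i
  coord-cong x≈y = comb-injective _ _ (trans (comb-coord _) (trans x≈y (sym (comb-coord _))))

  -- Coordinates and combinations are injections in opposite directions between the elements of L
  -- and the coordinate tuples over K.
  card≡card^degree : N ≡ q ℕ.^ degree
  card≡card^degree = ℕₚ.≤-antisym (Finₚ.injective⇒≤ to-injective) (Finₚ.injective⇒≤ from-injective)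
    where
    to : Fin N → Fin (q ℕ.^ degree)
    to i = funToFin (FK.index ∘ coord (FL.elem i))

    from : Fin (q ℕ.^ degree) → Fin N
    from k = FL.index (comb (FK.elem ∘ finToFun k) basis)

    to-injective : ∀ {i j} → to i ≡ to j → i ≡ j
    to-injective {i} {j} eq =
        FL.elem-injective (trans (sym (comb-coord _)) (trans (comb-cong basis λ k → FK.index-injective
      (≡.trans (≡.sym (Finₚ.finToFun-funToFin (FK.index ∘ coord (FL.elem i)) k))
      (≡.trans (≡.cong (λ u → finToFun u k) eq) (Finₚ.finToFun-funToFin (FK.index ∘ coord (FL.elem j)) k))))
          (comb-coord _)))

    funToFin-cong : ∀ {m n} {f g : Fin m → Fin n} → (∀ i → f i ≡ g i) → funToFin f ≡ funToFin g
    funToFin-cong {zero}  f≗g = ≡.refl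
    funToFin-cong {suc m} f≗g = ≡.cong₂ Fin.combine (f≗g zero) (funToFin-cong (f≗g ∘ suc))

    from-injective : ∀ {k l} → from k ≡ from l → k ≡ l
    from-injective {k} {l} eq = ≡.trans (≡.sym (Finₚ.funToFin-finToFin {degree} {q} k)) (≡.trans
      (funToFin-cong λ i → FK.elem-injective (comb-injective _ _ (FL.index-injective eq) i))
      (Finₚ.funToFin-finToFin {degree} {q} l))

-- The characteristic

module Numerals {c ℓ} (F : Field c ℓ) where
  open Field F hiding (zero; _-_)
  open import Algebra.Properties.Semiring.Exp semiring
  open import Algebra.Properties.Semiring.Mult semiring using (×-homo-+; ×1-homo-*) renaming (_×_ to _×′_)

  ⟦_⟧ : ℕ → Carrier
  ⟦ n ⟧ = n ×′ 1#

  ⟦⟧-+ : ∀ m n → ⟦ m ℕ.+ n ⟧ ≈ ⟦ m ⟧ + ⟦ n ⟧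
  ⟦⟧-+ = ×-homo-+ 1#

  ⟦⟧-* : ∀ m n → ⟦ m ℕ.* n ⟧ ≈ ⟦ m ⟧ * ⟦ n ⟧
  ⟦⟧-* = ×1-homo-*

  ⟦⟧-^ : ∀ m n → ⟦ m ℕ.^ n ⟧ ≈ ⟦ m ⟧ ^ n
  ⟦⟧-^ m zero    = +-identityʳ 1#
  ⟦⟧-^ m (suc n) = trans (⟦⟧-* m (m ℕ.^ n)) (*-congˡ (⟦⟧-^ m n))

  ∣⇒⟦⟧≈0 : ∀ {m n} → m ∣ n → ⟦ m ⟧ ≈ 0# → ⟦ n ⟧ ≈ 0#
  ∣⇒⟦⟧≈0 {m} (divides k ≡.refl) ⟦m⟧≈0 = trans (⟦⟧-* k m) (trans (*-congˡ ⟦m⟧≈0) (zeroʳ _))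

  -- Expresses negation through a natural number, so that polynomials over ℕ can encode differences.
  ⟦pred⟧-* : ∀ M → ⟦ suc M ⟧ ≈ 0# → ∀ x → ⟦ M ⟧ * x ≈ - x
  ⟦pred⟧-* M ⟦sM⟧≈0 x = +-cancelˡ x _ _ (begin
    x + ⟦ M ⟧ * x         ≈⟨ +-congʳ (*-identityˡ x) ⟨
    1# * x + ⟦ M ⟧ * x    ≈⟨ distribʳ x 1# ⟦ M ⟧ ⟨
    ⟦ suc M ⟧ * x         ≈⟨ trans (*-congʳ ⟦sM⟧≈0) (zeroˡ x) ⟩
    0#                    ≈⟨ -‿inverseʳ x ⟨
    x + - x               ∎)
    where
    open import Algebra.Properties.Ring ring using (+-cancelˡ)
    open import Relation.Binary.Reasoning.Setoid setoid

-- The prime field of L and its order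

module PrimeField {c ℓ} (L : Field c ℓ) {M : ℕ} (cardL : HasCard L (suc (suc M))) where
  open Field L hiding (zero; _-_)
  open FiniteField L cardL
  open Numerals L
  open import Algebra.Properties.Semiring.Exp semiring using (_^_)
  open import Algebra.Properties.Ring ring using (+-cancelˡ)

  -- The prime field is carried by ℕ, with the equality of L pulled back along n ↦ n·1.
  rawRing′ : RawRing 0ℓ ℓ
  rawRing′ = record
    { Carrier = ℕ
    ; _≈_     = λ m n → ⟦ m ⟧ ≈ ⟦ n ⟧
    ; _+_     = ℕ._+_
    ; _*_     = ℕ._*_
    ; -_      = suc M ℕ.*_
    ; 0#      = 0
    ; 1#      = 1
    }

  ⟦⟧-isRingMonomorphism : IsRingMonomorphism rawRing′ (Field.rawRing L) ⟦_⟧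
  ⟦⟧-isRingMonomorphism = record
    { isRingHomomorphism = record
      { isSemiringHomomorphism = record
        { isNearSemiringHomomorphism = record
          { +-isMonoidHomomorphism = record
            { isMagmaHomomorphism = record
              { isRelHomomorphism = record { cong = λ eq → eq }
              ; homo              = ⟦⟧-+
              }
            ; ε-homo = refl
            }
          ; *-homo = ⟦⟧-*
          }
        ; 1#-homo = +-identityʳ 1#
        }
      ; -‿homo = λ n → trans (⟦⟧-* (suc M) n) (⟦pred⟧-* (suc M) card×1≈0 ⟦ n ⟧)
      }
    ; injective = λ eq → eq
    }

  primeField : Field 0ℓ ℓ
  primeField = record
    { commutativeRing = record
      { isCommutativeRing = RingMonomorphism.isCommutativeRing ⟦⟧-isRingMonomorphism isCommutativeRing }
    ; 1≉0     = λ eq → 1≉0 (trans (sym (+-identityʳ 1#)) eq)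
    -- With |L| = M + 2, the identity n^(M+1) = 1 makes n^M the inverse.
    ; inverse = λ n n≉0 → n ℕ.^ M ,
        trans (⟦⟧-* n (n ℕ.^ M)) (trans (*-congˡ (⟦⟧-^ n M)) (trans (power≈1 ≡.refl n≉0) (sym (+-identityʳ 1#))))
    }

  inclusion : Homomorphism primeField L
  inclusion = record
    { map    = ⟦_⟧
    ; cong   = λ eq → eq
    ; +-homo = ⟦⟧-+
    ; *-homo = ⟦⟧-*
    ; 1-homo = +-identityʳ 1#
    }

  abstract
    -- The candidates are 1, ..., |L|, and |L| itself vanishes by `card×1≈0`; the least candidate
    -- that vanishes is the characteristic.
    least : ∃ λ (i : Fin (suc (suc M))) → ¬ ¬ ⟦ suc (toℕ i) ⟧ ≈ 0#
          × (∀ (j : Fin.Fin′ i) → ¬ ⟦ suc (toℕ (Fin.inject j)) ⟧ ≈ 0#)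
    least = Finₚ.¬∀⟶∃¬-smallest (suc (suc M)) (λ i → ¬ ⟦ suc (toℕ i) ⟧ ≈ 0#) (λ i → Dec.¬? (⟦ suc (toℕ i) ⟧ ≈? 0#))
      λ ≉0 → ≉0 (Fin.fromℕ (suc M)) (trans (reflexive (≡.cong (⟦_⟧ ∘ suc) (Finₚ.toℕ-fromℕ (suc M)))) card×1≈0)

  p : ℕ
  p = suc (toℕ (proj₁ least))

  ⟦p⟧≈0 : ⟦ p ⟧ ≈ 0#
  ⟦p⟧≈0 = Dec.decidable-stable (⟦ p ⟧ ≈? 0#) (proj₁ (proj₂ least))

  ⟦⟧≈0-<p : ∀ {n} → n ℕ.< p → ⟦ n ⟧ ≈ 0# → n ≡ 0
  ⟦⟧≈0-<p {zero}  _ _ = ≡.refl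
  ⟦⟧≈0-<p {suc n} (ℕ.s≤s n<p) ⟦n⟧≈0 = contradiction
    (trans (reflexive (≡.cong (⟦_⟧ ∘ suc) (≡.trans (Finₚ.toℕ-inject (Fin.fromℕ< n<p)) (Finₚ.toℕ-fromℕ< n<p)))) ⟦n⟧≈0)
    (proj₂ (proj₂ least) (Fin.fromℕ< n<p))

  ⟦%p⟧ : ∀ n → ⟦ n % p ⟧ ≈ ⟦ n ⟧
  ⟦%p⟧ n = trans (sym (+-identityʳ _)) (trans (+-congˡ (sym (∣⇒⟦⟧≈0 (divides (n / p) ≡.refl) ⟦p⟧≈0)))
    (trans (sym (⟦⟧-+ (n % p) (n / p ℕ.* p))) (reflexive (≡.cong ⟦_⟧ (≡.sym (m≡m%n+[m/n]*n n p))))))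

  -- The remainder of `n` modulo `p` also vanishes in L, so it is zero by the minimality of `p`.
  ⟦⟧≈0⇒p∣ : ∀ {n} → ⟦ n ⟧ ≈ 0# → p ∣ n
  ⟦⟧≈0⇒p∣ {n} ⟦n⟧≈0 = m%n≡0⇒n∣m n p (⟦⟧≈0-<p (m%n<n n p) (trans (⟦%p⟧ n) ⟦n⟧≈0))

  ⟦⟧-injective-<p : ∀ {m n} → m ℕ.≤ n → n ℕ.< p → ⟦ m ⟧ ≈ ⟦ n ⟧ → m ≡ n
  ⟦⟧-injective-<p {m} {n} m≤n n<p eq = ℕₚ.≤-antisym m≤n (ℕₚ.m∸n≡0⇒m≤n (⟦⟧≈0-<p (ℕₚ.≤-<-trans (ℕₚ.m∸n≤m n m) n<p)
    (+-cancelˡ ⟦ m ⟧ _ _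
        (trans (sym (⟦⟧-+ m (n ℕ.∸ m)))
            (trans (reflexive (≡.cong ⟦_⟧ (ℕₚ.m+[n∸m]≡n m≤n))) (trans (sym eq) (sym (+-identityʳ _))))))))

  primeField-card : HasCard primeField p
  primeField-card = toℕ
    , (λ n → n mod p , trans (reflexive (≡.cong ⟦_⟧ (Finₚ.toℕ-fromℕ< (m%n<n n p)))) (⟦%p⟧ n))
    , λ i j eq → Finₚ.toℕ-injective (injective i j eq)
    where
    injective : ∀ (i j : Fin p) → ⟦ toℕ i ⟧ ≈ ⟦ toℕ j ⟧ → toℕ i ≡ toℕ j
    injective i j eq with ℕₚ.≤-total (toℕ i) (toℕ j)
    ... | inj₁ i≤j = ⟦⟧-injective-<p i≤j (Finₚ.toℕ<n j) eq
    ... | inj₂ j≤i = ≡.sym (⟦⟧-injective-<p j≤i (Finₚ.toℕ<n i) (sym eq))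

  open FiniteExtension inclusion primeField-card cardL using (degree; card≡card^degree) public

  module _ {c′ ℓ′} (K : Field c′ ℓ′) {q : ℕ} (cardK : HasCard K q) where
    private
      module K  = Field K
      module NK = Numerals K
      module FK = FiniteField K cardK

    -- Since |L| is a power of p, any field in which |L|·1 = 0 has characteristic p as well.
    characteristic-unique : NK.⟦ suc (suc M) ⟧ K.≈ K.0# → ∀ n → ⟦ n ⟧ ≈ 0# → NK.⟦ n ⟧ K.≈ K.0#
    characteristic-unique N≈0 n ⟦n⟧≈0 =
        NK.∣⇒⟦⟧≈0 (⟦⟧≈0⇒p∣ {n} ⟦n⟧≈0) (Dec.decidable-stable (NK.⟦ p ⟧ FK.≈? K.0#) λ p≉0 →
      FK.^≉0 degree p≉0 (K.trans (K.sym (NK.⟦⟧-^ p degree))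
        (K.trans (K.reflexive (≡.cong NK.⟦_⟧ (≡.sym card≡card^degree))) N≈0)))

-- Polynomials in several variables and the embedding of K into L

infixl 6 _⊕_
infixl 7 _⊗_
-- Constants are natural numbers, so one and the same term has values in K and in L.
data Term (n : ℕ) : Set where
  var     : Fin n → Term n
  con     : ℕ → Term n
  _⊕_ _⊗_ : Term n → Term n → Term n

_⊛_ : ∀ {n} → Term n → ℕ → Term n
t ⊛ zero  = con 1
t ⊛ suc k = t ⊗ (t ⊛ k)

⨂ : ∀ {n k} → (Fin k → Term n) → Term n
⨂ {k = zero}  t = con 1
⨂ {k = suc k} t = t zero ⊗ ⨂ (t ∘ suc)

value : Term 0 → ℕ
value (con n) = n
value (s ⊕ t) = value s ℕ.+ value t
value (s ⊗ t) = value s ℕ.* value t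

-- Multiplication by X with `a` as the new constant term; the coefficient pushed out at the top is
-- returned separately.
push : ∀ {a} {A : Set a} {k} → A → Vec A (suc k) → Vec A (suc k) × A
push a (b ∷ [])     = a ∷ [] , b
push a (b ∷ v@(_ ∷ _)) = let w , l = push b v in a ∷ w , l

-- Coefficient vectors of length 2 + k stand for polynomials modulo X^(2+k) - X.
shift : ∀ {n k} → Vec (Term n) (suc (suc k)) → Vec (Term n) (suc (suc k))
shift v with push (con 0) v
... | a ∷ b ∷ w , l = a ∷ b ⊕ l ∷ w

-- Horner's rule in the first factor: (a + X v) w = a w + X (v w).
multiply : ∀ {n k l} → Vec (Term n) l → Vec (Term n) (suc (suc k)) → Vec (Term n) (suc (suc k))
multiply []      w = Vec.replicate _ (con 0)
multiply (a ∷ v) w = Vec.zipWith _⊕_ (Vec.map (a ⊗_) w) (shift (multiply v w))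

-- Only the variable `zero` plays the part of X; the other variables stay inside the coefficients,
-- to be treated by recursion later.
coefficients : ∀ {n k} → Term (suc n) → Vec (Term n) (suc (suc k))
coefficients (var zero)    = con 0 ∷ con 1 ∷ Vec.replicate _ (con 0)
coefficients (var (suc i)) = var i ∷ Vec.replicate _ (con 0)
coefficients (con c)       = con c ∷ Vec.replicate _ (con 0)
coefficients (s ⊕ t)       = Vec.zipWith _⊕_ (coefficients s) (coefficients t)
coefficients {k = k} (s ⊗ t) = multiply (coefficients {k = k} s) (coefficients t)

-- Values of terms, and their invariance under reduction of the first variable

module TermEvaluation {c ℓ} (F : Field c ℓ) {q : ℕ} (card : HasCard F q) where
  open Field F hiding (zero; _-_)
  open FiniteField F card
  open Numerals F
  open import Algebra.Properties.Semiring.Exp semiring using (_^_)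
  open import Relation.Binary.Reasoning.Setoid setoid

  infix 9 _⟪_⟫
  _⟪_⟫ : ∀ {n} → Term n → (Fin n → Carrier) → Carrier
  var i   ⟪ ρ ⟫ = ρ i
  con c   ⟪ ρ ⟫ = ⟦ c ⟧
  (s ⊕ t) ⟪ ρ ⟫ = s ⟪ ρ ⟫ + t ⟪ ρ ⟫
  (s ⊗ t) ⟪ ρ ⟫ = s ⟪ ρ ⟫ * t ⟪ ρ ⟫

  ⟪⟫-value : ∀ t (ρ : Fin 0 → Carrier) → t ⟪ ρ ⟫ ≈ ⟦ value t ⟧
  ⟪⟫-value (con n) ρ = refl
  ⟪⟫-value (s ⊕ t) ρ = trans (+-cong (⟪⟫-value s ρ) (⟪⟫-value t ρ)) (sym (⟦⟧-+ (value s) (value t)))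
  ⟪⟫-value (s ⊗ t) ρ = trans (*-cong (⟪⟫-value s ρ) (⟪⟫-value t ρ)) (sym (⟦⟧-* (value s) (value t)))

  ⟪⟫-⊛ : ∀ {n} (t : Term n) k ρ → (t ⊛ k) ⟪ ρ ⟫ ≈ t ⟪ ρ ⟫ ^ k
  ⟪⟫-⊛ t zero    ρ = +-identityʳ 1#
  ⟪⟫-⊛ t (suc k) ρ = *-congˡ (⟪⟫-⊛ t k ρ)

  ⨂≈1 : ∀ {n k} (t : Fin k → Term n) {ρ} → (∀ i → t i ⟪ ρ ⟫ ≈ 1#) → ⨂ t ⟪ ρ ⟫ ≈ 1#
  ⨂≈1 {k = zero}  t t≈1 = +-identityʳ 1#
  ⨂≈1 {k = suc k} t t≈1 = trans (*-cong (t≈1 zero) (⨂≈1 (t ∘ suc) (t≈1 ∘ suc))) (*-identityˡ 1#)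

  ⨂≉0 : ∀ {n k} (t : Fin k → Term n) {ρ} → ¬ ⨂ t ⟪ ρ ⟫ ≈ 0# → ∀ i → ¬ t i ⟪ ρ ⟫ ≈ 0#
  ⨂≉0 t Πt≉0 zero    t≈0 = Πt≉0 (trans (*-congʳ t≈0) (zeroˡ _))
  ⨂≉0 t Πt≉0 (suc i) t≈0 = ⨂≉0 (t ∘ suc) (λ Πt≈0 → Πt≉0 (trans (*-congˡ Πt≈0) (zeroʳ _))) i t≈0

  module _ {n} (ψ : Fin (suc n) → Carrier) where
    private
      x = ψ zero
      ρ = ψ ∘ suc
    open Algebra.Solver.Ring.NaturalCoefficients.Default commutativeSemiring

    evalTerms : ∀ {k} → Vec (Term n) k → Carrier
    evalTerms v = eval (Vec.map _⟪ ρ ⟫ v) x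

    evalTerms-replicate-0 : ∀ k → evalTerms (Vec.replicate k (con 0)) ≈ 0#
    evalTerms-replicate-0 zero    = refl
    evalTerms-replicate-0 (suc k) = trans (+-identityˡ _) (trans (*-congˡ (evalTerms-replicate-0 k)) (zeroʳ x))

    evalTerms-constant : ∀ k t → evalTerms (t ∷ Vec.replicate k (con 0)) ≈ t ⟪ ρ ⟫
    evalTerms-constant k t = trans (+-congˡ (trans (*-congˡ (evalTerms-replicate-0 k)) (zeroʳ x))) (+-identityʳ _)

    evalTerms-⊕ : ∀ {k} (v w : Vec (Term n) k) → evalTerms (Vec.zipWith _⊕_ v w) ≈ evalTerms v + evalTerms w
    evalTerms-⊕ []      []      = sym (+-identityˡ 0#)
    evalTerms-⊕ (a ∷ v) (b ∷ w) = trans (+-congˡ (*-congˡ (evalTerms-⊕ v w)))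
      (solve 5 (λ a b x v w → (a :+ b) :+ x :* (v :+ w) := (a :+ x :* v) :+ (b :+ x :* w)) refl _ _ x _ _)

    evalTerms-⊗ : ∀ {k} a (v : Vec (Term n) k) → evalTerms (Vec.map (a ⊗_) v) ≈ a ⟪ ρ ⟫ * evalTerms v
    evalTerms-⊗ a []      = sym (zeroʳ _)
    evalTerms-⊗ a (b ∷ v) = trans (+-congˡ (*-congˡ (evalTerms-⊗ a v)))
      (solve 4 (λ a b x v → a :* b :+ x :* (a :* v) := a :* (b :+ x :* v)) refl _ _ x _)

    evalTerms-push : ∀ {k} a (v : Vec (Term n) (suc k)) → let w , l = push a v in
                     a ⟪ ρ ⟫ + x * evalTerms v ≈ evalTerms w + x ^ suc k * l ⟪ ρ ⟫
    evalTerms-push a (b ∷ []) =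
        solve 3 (λ a b x → a :+ x :* (b :+ x :* con 0) := (a :+ x :* con 0) :+ (x :* con 1) :* b) refl _ _ x
    evalTerms-push {suc k} a (b ∷ v@(_ ∷ _)) = trans (+-congˡ (*-congˡ (evalTerms-push b v)))
      (solve 5 (λ a x w y l → a :+ x :* (w :+ y :* l) := (a :+ x :* w) :+ (x :* y) :* l) refl _ x _ (x ^ suc k) _)

    module _ {k} (x^≈x : x ^ suc (suc k) ≈ x) where

      -- The coefficient pushed out stands at X^(2+k), whose value is that of X, so it may be added
      -- to the coefficient of X.
      evalTerms-shift : (v : Vec (Term n) (suc (suc k))) → evalTerms (shift v) ≈ x * evalTerms v
      evalTerms-shift v with push (con 0) v | evalTerms-push (con 0) v
      ... | a ∷ b ∷ w , l | eq = begin
        A + x * ((B + L) + x * W)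
            ≈⟨ solve 5 (λ a b l x w → a :+ x :* ((b :+ l) :+ x :* w) :=
                (a :+ x :* (b :+ x :* w)) :+ x :* l) refl A B L x W ⟩
        (A + x * (B + x * W)) + x * L                   ≈⟨ +-congˡ (*-congʳ x^≈x) ⟨
        (A + x * (B + x * W)) + x ^ suc (suc k) * L     ≈⟨ eq ⟨
        0# + x * evalTerms v                            ≈⟨ +-identityˡ _ ⟩
        x * evalTerms v                                 ∎
        where
        A = a ⟪ ρ ⟫
        B = b ⟪ ρ ⟫
        L = l ⟪ ρ ⟫
        W = evalTerms w

      evalTerms-multiply : ∀ {l} (v : Vec (Term n) l) (w : Vec (Term n) (suc (suc k))) →
                           evalTerms (multiply v w) ≈ evalTerms v * evalTerms w
      evalTerms-multiply []      w = trans (evalTerms-replicate-0 (suc (suc k))) (sym (zeroˡ _))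
      evalTerms-multiply (a ∷ v) w = begin
        evalTerms (Vec.zipWith _⊕_ (Vec.map (a ⊗_) w) (shift (multiply v w)))   ≈⟨ evalTerms-⊕ (Vec.map (a ⊗_) w) _ ⟩
        evalTerms (Vec.map (a ⊗_) w) + evalTerms (shift (multiply v w))
            ≈⟨ +-cong (evalTerms-⊗ a w) (trans (evalTerms-shift (multiply v w)) (*-congˡ (evalTerms-multiply v w))) ⟩
        A * W + x * (V * W)
            ≈⟨ solve 4 (λ a w x v → a :* w :+ x :* (v :* w) := (a :+ x :* v) :* w) refl A W x V ⟩
        (A + x * V) * W                                                         ∎
        where
        A = a ⟪ ρ ⟫
        V = evalTerms v
        W = evalTerms w

      ⟪⟫-coefficients : ∀ t → t ⟪ ψ ⟫ ≈ evalTerms (coefficients {k = k} t)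
      ⟪⟫-coefficients (var zero)    =
          sym (trans (+-identityˡ _)
              (trans (*-congˡ (trans (evalTerms-constant k (con 1)) (+-identityʳ 1#))) (*-identityʳ x)))
      ⟪⟫-coefficients (var (suc i)) = sym (evalTerms-constant (suc k) (var i))
      ⟪⟫-coefficients (con c)       = sym (evalTerms-constant (suc k) (con c))
      ⟪⟫-coefficients (s ⊕ t)       =
          trans (+-cong (⟪⟫-coefficients s) (⟪⟫-coefficients t)) (sym (evalTerms-⊕ (coefficients s) (coefficients t)))
      ⟪⟫-coefficients (s ⊗ t)       =
          trans (*-cong (⟪⟫-coefficients s) (⟪⟫-coefficients t))
              (sym (evalTerms-multiply (coefficients {k = k} s) (coefficients t)))


-- The embedding of K into L

module FieldEmbedding {c ℓ c′ ℓ′} (K : Field c ℓ) (L : Field c′ ℓ′) {q M : ℕ}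
                      (cardK : HasCard K q) (cardL : HasCard L (suc (suc M))) where
  private
    module K  = Field K
    module L  = Field L
    module FK = FiniteField K cardK
    module FL = FiniteField L cardL
    module NK = Numerals K
    module NL = Numerals L
    module TK = TermEvaluation K cardK
    module TL = TermEvaluation L cardL
    module SK = Algebra.Properties.Semiring.Exp K.semiring
    module SL = Algebra.Properties.Semiring.Exp L.semiring
    open import Algebra.Properties.Ring L.ring using (x∙y⁻¹≈ε⇒x≈y)
    N : ℕ
    N = suc (suc M)

  -- These two properties link K to `N` = |L|; both hold when `N` is a positive power of |K|.
  module _ (N≈0 : NK.⟦ N ⟧ K.≈ K.0#) (x^N≈x : ∀ x → x SK.^ N K.≈ x) where
    open PrimeField L cardL using (characteristic-unique)

    infix 4 _≉0ᴷ[_] _≉0ᴸ[_]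
    _≉0ᴷ[_] : ∀ {n} → Term n → (Fin n → K.Carrier) → Set ℓ
    t ≉0ᴷ[ ψ ] = ¬ t TK.⟪ ψ ⟫ K.≈ K.0#

    _≉0ᴸ[_] : ∀ {n} → Term n → (Fin n → L.Carrier) → Set ℓ′
    t ≉0ᴸ[ ψ ] = ¬ t TL.⟪ ψ ⟫ L.≈ L.0#

    -- As a polynomial in the first variable, t has degree < N = |L|, so it does not vanish on L
    -- unless all its coefficients do.
    nonvanishing-transfer : ∀ {n} (t : Term n) ψ → t ≉0ᴷ[ ψ ] → ∃ λ φ → t ≉0ᴸ[ φ ]
    -- Without variables the term is a numeral, and a numeral that vanishes in L vanishes in K.
    nonvanishing-transfer {zero}  t ψ t≉0 = (λ ()) , λ t≈0 → t≉0 (K.trans (TK.⟪⟫-value t ψ)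
      (characteristic-unique K cardK N≈0 (value t) (L.trans (L.sym (TL.⟪⟫-value t _)) t≈0)))
    nonvanishing-transfer {suc n} t ψ t≉0 =
        x Vector.∷ φ , λ t≈0 → x-nonRoot (L.trans (L.sym (TL.⟪⟫-coefficients (x Vector.∷ φ) (FL.x^card≈x x) t)) t≈0)
      where
      transferAny : ∀ {k} (v : Vec (Term n) k) → Any _≉0ᴷ[ ψ ∘ suc ] v → ∃ λ φ → Any _≉0ᴸ[ φ ] v
      transferAny (a ∷ v) (here a≉0)  = let φ , a≉0′ = nonvanishing-transfer a (ψ ∘ suc) a≉0 in φ , here a≉0′
      transferAny (a ∷ v) (there v≉0) = let φ , v≉0′ = transferAny v v≉0 in φ , there v≉0′

      -- The length M + 2 is |L|: reduction preserves values in K by `x^N≈x`, and the degree is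
      -- small enough for a non-root in L.
      v = coefficients {k = M} t

      transferred = transferAny v (map⁻ (FK.eval≉0⇒≉0 (Vec.map TK._⟪ ψ ∘ suc ⟫ v) (ψ zero)
        λ v≈0 → t≉0 (K.trans (TK.⟪⟫-coefficients ψ (x^N≈x (ψ zero)) t) v≈0)))
      φ = proj₁ transferred

      nonRoot = FL.≉0⇒nonRoot (Vec.map TL._⟪ φ ⟫ v) (map⁺ (proj₂ transferred))
      x         = proj₁ nonRoot
      x-nonRoot = proj₂ nonRoot

    infix 8 ⊝_
    ⊝_ : ∀ {n} → Term n → Term n
    ⊝ t = con (suc M) ⊗ t

    -- The term 1 - t^(N-1), which on L is the characteristic function of the zero set of `t`.
    indicator : ∀ {n} → Term n → Term n
    indicator t = con 1 ⊕ ⊝ (t ⊛ suc M)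

    indicator≈1 : ∀ {n} (t : Term n) ψ → t TK.⟪ ψ ⟫ K.≈ K.0# → indicator t TK.⟪ ψ ⟫ K.≈ K.1#
    indicator≈1 t ψ t≈0 = K.trans (K.+-cong (K.+-identityʳ K.1#) (K.trans (K.*-congˡ
      (K.trans (TK.⟪⟫-⊛ t (suc M) ψ) (K.trans (K.*-congʳ t≈0) (K.zeroˡ _)))) (K.zeroʳ _))) (K.+-identityʳ K.1#)

    -- A nonzero value of `t` has (N-1)-st power 1, which makes the indicator zero.
    indicator≉0 : ∀ {n} (t : Term n) φ → indicator t ≉0ᴸ[ φ ] → t TL.⟪ φ ⟫ L.≈ L.0#
    indicator≉0 t φ ≉0 = Dec.decidable-stable (t TL.⟪ φ ⟫ FL.≈? L.0#) λ t≉0 → ≉0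
      (L.trans (L.+-cong (L.+-identityʳ L.1#) (L.trans (NL.⟦pred⟧-* (suc M) FL.card×1≈0 _)
        (L.-‿cong (L.trans (TL.⟪⟫-⊛ t (suc M) φ) (FL.power≈1 ≡.refl t≉0)))))
        (L.-‿inverseʳ L.1#))

    -- The variable `i` stands for the image of the element `FK.elem i` under the homomorphism
    -- sought.
    sum-relation product-relation : Fin q → Fin q → Term q
    sum-relation i j     = var (FK.index (FK.elem i K.+ FK.elem j)) ⊕ ⊝ (var i ⊕ var j)
    product-relation i j = var (FK.index (FK.elem i K.* FK.elem j)) ⊕ ⊝ (var i ⊗ var j)

    one-relation : Term q
    one-relation = var (FK.index K.1#) ⊕ ⊝ con 1

    homomorphism-indicator : Term q
    homomorphism-indicator =
        indicator one-relation ⊗ ⨂ λ i → ⨂ λ j → indicator (sum-relation i j) ⊗ indicator (product-relation i j)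

    homomorphism-indicator≈1 : homomorphism-indicator TK.⟪ FK.elem ⟫ K.≈ K.1#
    homomorphism-indicator≈1 = K.trans (K.*-cong
      (indicator≈1 one-relation FK.elem (relation (K.trans (FK.elem-index K.1#) (K.sym (K.+-identityʳ _)))))
      (TK.⨂≈1 _ λ i → TK.⨂≈1 _ λ j → K.trans (K.*-cong
        (indicator≈1 (sum-relation i j) FK.elem (relation (FK.elem-index _)))
        (indicator≈1 (product-relation i j) FK.elem (relation (FK.elem-index _))))
        (K.*-identityˡ K.1#)))
      (K.*-identityˡ K.1#)
      where
      relation : ∀ {x y} → x K.≈ y → x K.+ NK.⟦ suc M ⟧ K.* y K.≈ K.0#
      relation x≈y = K.trans (K.+-cong x≈y (NK.⟦pred⟧-* (suc M) N≈0 _)) (K.-‿inverseʳ _)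

    embedding : Homomorphism K L
    embedding = record
      { map    = φ ∘ FK.index
      ; cong   = λ x≈y → L.reflexive (≡.cong φ (FK.index-cong x≈y))
      -- The relations speak of listed elements only, so `x` and `y` are first replaced by the list
      -- entries equal to them.
      ; +-homo = λ x y → L.trans
          (L.reflexive (≡.cong φ (FK.index-cong (K.+-cong (K.sym (FK.elem-index x)) (K.sym (FK.elem-index y))))))
          (relation (indicator≉0 (sum-relation _ _) φ (λ ≈0 → pair≉0 _ _ (L.trans (L.*-congʳ ≈0) (L.zeroˡ _)))))
      ; *-homo = λ x y → L.trans
          (L.reflexive (≡.cong φ (FK.index-cong (K.*-cong (K.sym (FK.elem-index x)) (K.sym (FK.elem-index y))))))
          (relation (indicator≉0 (product-relation _ _) φ (λ ≈0 → pair≉0 _ _ (L.trans (L.*-congˡ ≈0) (L.zeroʳ _)))))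
      ; 1-homo = L.trans (relation
          (indicator≉0 one-relation φ (λ ≈0 → φ≉0 (L.trans (L.*-congʳ ≈0) (L.zeroˡ _))))) (L.+-identityʳ _)
      }
      where
      assignment : ∃ λ φ → homomorphism-indicator ≉0ᴸ[ φ ]
      assignment = nonvanishing-transfer homomorphism-indicator FK.elem
          λ ≈0 → K.1≉0 (K.trans (K.sym homomorphism-indicator≈1) ≈0)

      φ   = proj₁ assignment
      φ≉0 = proj₂ assignment

      pair≉0 : ∀ i j → indicator (sum-relation i j) ⊗ indicator (product-relation i j) ≉0ᴸ[ φ ]
      pair≉0 i j = TL.⨂≉0 _ (TL.⨂≉0 _ (λ ≈0 → φ≉0 (L.trans (L.*-congˡ ≈0) (L.zeroʳ _))) i) j

      relation : ∀ {x y} → x L.+ NL.⟦ suc M ⟧ L.* y L.≈ L.0# → x L.≈ y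
      relation eq = x∙y⁻¹≈ε⇒x≈y _ _ (L.trans (L.+-congˡ (L.sym (NL.⟦pred⟧-* (suc M) FL.card×1≈0 _))) eq)

-- Restriction of scalars

open import Data.Nat using (_*_; _^_; _≤_; _∸_)

module _ {c ℓ} (S : Semiring c ℓ) where
  open Semiring S hiding (zero; _*_)
  open Algebra.Properties.Semiring.Sum S

  sum-↑ : ∀ m {n} (f : Fin (m ℕ.+ n) → Carrier) → sum f ≈ sum (f ∘ (_↑ˡ n)) + sum (f ∘ (m ↑ʳ_))
  sum-↑ zero    f = sym (+-identityˡ _)
  sum-↑ (suc m) f = trans (+-congˡ (sum-↑ m (f ∘ suc))) (sym (+-assoc _ _ _))

  sum-combine : ∀ d {m} (f : Fin (d * m) → Carrier) → sum f ≈ ∑[ i < d ] ∑[ j < m ] f (combine i j)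
  sum-combine zero        f = refl
  sum-combine (suc d) {m} f = trans (sum-↑ m f) (+-congˡ (sum-combine d (f ∘ (m ↑ʳ_))))

module _ {c ℓ} (F : Field c ℓ) where
  open Field F hiding (zero) renaming (_*_ to _*ᶠ_)
  open LinAlg F renaming (Vec to Vector)
  open Algebra.Properties.Semiring.Sum semiring

  lincomb-sum : ∀ {I} d (cs : Fin d → Carrier) (bs : Fin d → Vector I) i →
                lincomb d cs bs i ≡ ∑[ k < d ] (cs k *ᶠ bs k i)
  lincomb-sum zero    cs bs i = ≡.refl
  lincomb-sum (suc d) cs bs i = ≡.cong (cs zero *ᶠ bs zero i +_) (lincomb-sum d (cs ∘ suc) (bs ∘ suc) i)

  -- The block length is a parameter so that a covering built for the degree of the extension can be
  -- transported to `m`.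
  HasCoveringOfCodim : ℕ → ℕ → ℕ → Set _
  HasCoveringOfCodim m n k =
      ∃ λ (U : Subset (Fin n × Fin m)) → IsSubspace U × Covering (τ₃ F) n U × HasCodim (m * n) U k

module RestrictionOfScalars {c ℓ} {K L : Field c ℓ} (φ : Homomorphism K L)
                            {q N : ℕ} (cardK : HasCard K q) (cardL : HasCard L N) where
  open FiniteExtension φ cardK cardL renaming (degree to m)
  private
    module K  = Field K
    module L  = Field L
    module LK = LinAlg K
    module LL = LinAlg L
    module φ  = Homomorphism φ
    open Algebra.Properties.Semiring.Sum L.semiring using (sum-syntax; sum-cong-≋; *-distribʳ-sum)
    open LL.IsSubspace
    open import Relation.Binary.Reasoning.Setoid L.setoid

  coords : ∀ {n} → LL.Vec (Fin n) → LK.Vec (Fin n × Fin m)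
  coords u (j , p) = coord (u j) p

  combs : ∀ {n} → LK.Vec (Fin n × Fin m) → LL.Vec (Fin n)
  combs v j = comb (λ p → v (j , p)) basis

  -- Both shifts move only the block index, whereas `coords` acts inside each block.
  iter-τ₃-coords : ∀ {n} i (u : LL.Vec (Fin n)) x → LK.iter (τ₃ K) i (coords u) x ≡ coords (LL.iter (τ L) i u) x
  iter-τ₃-coords zero    u x       = ≡.refl
  iter-τ₃-coords (suc i) u (j , p) = iter-τ₃-coords i u (rot j , p)

  combs-lincomb : ∀ {n} d cs (ws : Fin d → LK.Vec (Fin n × Fin m)) j →
                  combs (LK.lincomb d cs ws) j L.≈ ∑[ k < d ] (φ.map (cs k) L.* combs (ws k) j)
  combs-lincomb zero    cs ws j = comb-0 basis
  combs-lincomb (suc d) cs ws j = L.trans (comb-+ _ _ basis)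
    (L.+-cong (comb-* (cs zero) _ basis) (combs-lincomb d (cs ∘ suc) (ws ∘ suc) j))

  module _ {n} {U : LL.Subset (Fin n)} (isSubspace : LL.IsSubspace U) where

    U′ : LK.Subset (Fin n × Fin m)
    U′ v = U (combs v)

    U′-isSubspace : LK.IsSubspace U′
    U′-isSubspace = record
      { respects = λ u≈v → respects isSubspace (λ j → comb-cong basis (λ p → u≈v (j , p)))
      ; has-0    = respects isSubspace (λ j → L.sym (comb-0 basis)) (has-0 isSubspace)
      ; closed-+ = λ u∈U v∈U → respects isSubspace (λ j → L.sym (comb-+ _ _ basis)) (closed-+ isSubspace u∈U v∈U)
      ; closed-· = λ a u∈U → respects isSubspace (λ j → L.sym (comb-* a _ basis)) (closed-· isSubspace (φ.map a) u∈U)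
      }

    coords∈U′ : ∀ {u} → U u → U′ (coords u)
    coords∈U′ = respects isSubspace (λ j → L.sym (comb-coord _))

    -- The vector `combs x` lies in some shift of `U`; taking coordinates returns `x` and turns that
    -- shift into the same power of `τ₃`.
    U′-covering : LL.Covering (τ L) n U → LK.Covering (τ₃ K) n U′
    U′-covering cover x with i , u , u∈U , x≈ ← cover (combs x) = i , coords u , coords∈U′ u∈U , λ (j , p) →
      K.trans (K.sym (coord-comb _ p))
          (K.trans (coord-cong (x≈ j) p) (K.reflexive (≡.sym (iter-τ₃-coords (toℕ i) u (j , p)))))

    module _ {d} (bs : Fin d → LL.Vec (Fin n)) where

      -- The usual basis for a tower: each vector of `bs` multiplied by each element of `basis`.
      productBasis : Fin (d * m) → LK.Vec (Fin n × Fin m)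
      productBasis k = let i , p = remQuot m k in coords (basis p LL.·v bs i)

      -- Grouping the K-coefficients into `d` blocks of `m` gives one L-coefficient per vector of
      -- `bs`; this reduces independence and spanning over K to `bs` and `basis`.
      combs-lincomb-productBasis : ∀ cs → combs (LK.lincomb (d * m) cs productBasis)
                                   LL.≈v LL.lincomb d (λ i → comb (λ p → cs (combine i p)) basis) bs
      combs-lincomb-productBasis cs j = begin
        combs (LK.lincomb (d * m) cs productBasis) j
          ≈⟨ combs-lincomb (d * m) cs productBasis j ⟩
        ∑[ k < d * m ] (φ.map (cs k) L.* combs (productBasis k) j)
          ≈⟨ sum-combine L.semiring d (λ k → φ.map (cs k) L.* combs (productBasis k) j) ⟩
        ∑[ i < d ] ∑[ p < m ] (φ.map (cs (combine i p)) L.* combs (productBasis (combine i p)) j)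
          ≈⟨ sum-cong-≋ (λ i → sum-cong-≋ λ p → L.*-congˡ (L.trans (comb-coord _)
               (L.reflexive (≡.cong (λ (i , p) → basis p L.* bs i j) (Finₚ.remQuot-combine i p))))) ⟩
        ∑[ i < d ] ∑[ p < m ] (φ.map (cs (combine i p)) L.* (basis p L.* bs i j))
          ≈⟨ sum-cong-≋ (λ i → L.trans (*-distribʳ-sum (bs i j) (λ p → φ.map (cs (combine i p)) L.* basis p))
              (sum-cong-≋ {m} λ p → L.*-assoc _ _ _)) ⟨
        ∑[ i < d ] (comb (λ p → cs (combine i p)) basis L.* bs i j)
          ≡⟨ lincomb-sum L d (λ i → comb (λ p → cs (combine i p)) basis) bs j ⟨
        LL.lincomb d (λ i → comb (λ p → cs (combine i p)) basis) bs j ∎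

    U′-hasDim : ∀ {d} → LL.HasDim U d → LK.HasDim U′ (d * m)
    U′-hasDim {d} (bs , bs∈U , bs-indep , bs-span) = productBasis bs
      , (λ k → coords∈U′ (closed-· isSubspace _ (bs∈U _)))
      -- Independence of `bs` kills the L-coefficient of each block, then independence of `basis`
      -- kills the entries of the block.
      , (λ cs cs·b≈0 k → ≡.subst (λ k → cs k K.≈ K.0#) (Finₚ.combine-remQuot {d} m k)
          (uncurry (λ i → basis-independent (λ p → cs (combine i p))
            (bs-indep (λ i → comb (λ p → cs (combine i p)) basis)
              (λ j → L.trans (L.sym (combs-lincomb-productBasis bs cs j))
                  (L.trans (comb-cong basis (λ p → cs·b≈0 (j , p))) (comb-0 basis))) i))
            (remQuot {d} m k)))
      , λ v v∈U′ → span v (bs-span (combs v) v∈U′)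
      where
      span : ∀ v → (∃ λ ds → combs v LL.≈v LL.lincomb d ds bs) →
             ∃ λ cs → v LK.≈v LK.lincomb (d * m) cs (productBasis bs)
      span v (ds , v≈) = cs , λ (j , p) → comb-injective _ _ (begin
        combs v j                                                          ≈⟨ v≈ j ⟩
        LL.lincomb d ds bs j                                               ≡⟨ lincomb-sum L d ds bs j ⟩
        ∑[ i < d ] (ds i L.* bs i j)
            ≈⟨ sum-cong-≋ (λ i → L.*-congʳ (L.trans (comb-cong basis λ p →
             K.reflexive (≡.cong (λ (i , p) → coord (ds i) p) (Finₚ.remQuot-combine i p))) (comb-coord (ds i)))) ⟨
        ∑[ i < d ] (comb (λ p → cs (combine i p)) basis L.* bs i j)
            ≡⟨ lincomb-sum L d (λ i → comb (λ p → cs (combine i p)) basis) bs j ⟨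
        LL.lincomb d (λ i → comb (λ p → cs (combine i p)) basis) bs j      ≈⟨ combs-lincomb-productBasis bs cs j ⟨
        combs (LK.lincomb (d * m) cs (productBasis bs)) j                  ∎) p
        where
        cs : Fin (d * m) → K.Carrier
        cs k = let i , p = remQuot m k in coord (ds i) p

    U′-hasCodim : ∀ {k} → LL.HasCodim n U k → LK.HasCodim (m * n) U′ (m * k)
    U′-hasCodim {k} (d , hasDim , ≡.refl) =
        d * m , U′-hasDim hasDim , solve 3 (λ d m k → d :* m :+ m :* k := m :* (d :+ k)) ≡.refl d m k
      where open +-*-Solver

-- Degree of the extension and comparison of codimensions

^-injectiveʳ : ∀ {q} m n → 1 ℕ.< q → q ^ m ≡ q ^ n → m ≡ n
^-injectiveʳ m n 1<q eq with ℕₚ.<-cmp m n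
... | tri< m<n _ _ = contradiction eq (ℕₚ.<⇒≢ (ℕₚ.^-monoʳ-< _ 1<q m<n))
... | tri≈ _ m≡n _ = m≡n
... | tri> _ _ m>n = contradiction (≡.sym eq) (ℕₚ.<⇒≢ (ℕₚ.^-monoʳ-< _ 1<q m>n))

module _ {c ℓ} {q m : ℕ} (K : Field c ℓ) (cardK : HasCard K q) (L : Field c ℓ) (cardL : HasCard L (q ^ m)) where
  private
    module K  = Field K
    module FK = FiniteField K cardK
    module FL = FiniteField L cardL
    module NK = Numerals K
    module Exp = Algebra.Properties.Semiring.Exp K.semiring

  degree>0 : 0 ℕ.< m
  -- For m = 0 the field L would have a single element.
  degree>0 = ℕₚ.n≢0⇒n>0 λ { ≡.refl → contradiction FL.card>1 (ℕₚ.<-irrefl ≡.refl) }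

  q^m×1≈0 : NK.⟦ q ^ m ⟧ K.≈ K.0#
  q^m×1≈0 = NK.∣⇒⟦⟧≈0 (q∣q^ degree>0) FK.card×1≈0
    where
    q∣q^ : ∀ {m} → 0 ℕ.< m → q ∣ q ^ m
    q∣q^ {suc m} _ = m∣m*n (q ^ m)

  -- Iterate x^q = x, splitting the power as (x^q)^(q^j).
  x^q^m≈x : ∀ j x → x Exp.^ (q ^ j) K.≈ x
  x^q^m≈x zero    x = K.*-identityʳ x
  x^q^m≈x (suc j) x = K.trans (K.sym (Exp.^-assocʳ x q (q ^ j))) (K.trans (x^q^m≈x j _) (FK.x^card≈x x))

  abstract
    subfield : Homomorphism K L
    subfield = build (q ^ m) cardL q^m×1≈0 (x^q^m≈x m)
      where
      -- Here `q ^ m` becomes a variable, so that it can be matched against M + 2; the orders 0 and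
      -- 1 are impossible.
      build : ∀ N → HasCard L N → NK.⟦ N ⟧ K.≈ K.0# → (∀ x → x Exp.^ N K.≈ x) → Homomorphism K L
      build 0             card = contradiction (FiniteField.card>1 L card) λ ()
      build 1             card = contradiction (FiniteField.card>1 L card) (ℕₚ.<-irrefl ≡.refl)
      build (suc (suc M)) card = FieldEmbedding.embedding K L cardK card

  open RestrictionOfScalars subfield cardK cardL
  open FiniteExtension subfield cardK cardL using (degree; card≡card^degree)

  restriction-covering : ∀ {n k} → hIs L n k → HasCoveringOfCodim K m n (m * k)
  restriction-covering {n} {k} ((U , isSubspace , covering , hasCodim) , _) =
    -- Comparing q^m = |L| = q^degree identifies the degree with `m`.
    ≡.subst (λ m → HasCoveringOfCodim K m n (m * k)) (≡.sym (^-injectiveʳ m degree FK.card>1 card≡card^degree))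
      (U′ isSubspace , U′-isSubspace isSubspace , U′-covering isSubspace covering , U′-hasCodim isSubspace hasCodim)

m*k≤m∸1⇒k≡0 : ∀ m k → 0 ℕ.< m → m * k ≤ m ∸ 1 → k ≡ 0
m*k≤m∸1⇒k≡0 m       zero    _ _  = ≡.refl
m*k≤m∸1⇒k≡0 (suc m) (suc k) _ le = contradiction (ℕₚ.≤-trans (ℕₚ.m≤m*n (suc m) (suc k)) le) ℕₚ.1+n≰n

theorem4p1 : ∀ {c ℓ} (q m n : ℕ) → .{{NonZero m}} → .{{NonZero n}} →
    (K : Field c ℓ) → HasCard K q → (L : Field c ℓ) → HasCard L (q ^ m) →
    (∀ k k' → hIs L n k → hτ₃Is K m n k' → m * k ≤ k')
    × (∀ k k' → hτ₃Is K m n k' → k' ≤ m ∸ 1 → hIs L n k → k ≡ 0)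
theorem4p1 q m n K cardK L cardL = mk≤k' , λ k k' hK k'≤m∸1 hL →
    m*k≤m∸1⇒k≡0 m k (degree>0 {m = m} K cardK L cardL) (ℕₚ.≤-trans (mk≤k' k k' hL hK) k'≤m∸1)
  where
  mk≤k' : ∀ k k' → hIs L n k → hτ₃Is K m n k' → m * k ≤ k'
  mk≤k' k k' hL (_ , maximal)
    with U , isSubspace , covering , hasCodim ← restriction-covering {m = m} K cardK L cardL hL =
    maximal U (m * k) isSubspace covering hasCodim
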